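{- Let $(\mathbb N,S)$ be the natural numbers with the unary successor function $S(n)=n+1$. For all $a,b,c,d\in\mathbb N$, $$(\mathbb N,S)\models_e a:b::c:d\iff a-b=c-d.$$
   Context: Equational fragment: for an $L$-structure $\mathfrak A$ and $a,b\in A$, the set of equational justifications is $\uparrow^e_{\mathfrak A}(a\to b)=\{s(x,y)=t(x,y): s,t\ L\text{ -terms in variables among }x,y,\ \text{the formula } s=t \text{ is a c-formula},\ \mathfrak A\models s(a,b)=t(a,b)\}$, where a c-formula is one whose free variables are exactly $x,y$ and whose dependency graph (vertices: its variables; edge between two variables iff they occur in a common atomic subformula) is connected. Put $\uparrow^e_{\mathfrak A}(a\to b:\cdot\, c\to d)=\uparrow^e_{\mathfrak A}(a\to b)\cap\uparrow^e_{\mathfrak A}(c\to d)$. An equation is trivial iff it lies in $\uparrow^e_{\mathfrak A}(a\to b:\cdot\, c\to d)$ for all $a,b,c,d$; $\emptyset^e$ denotes the set of trivial ones. $\mathfrak A\models_e a\to b:\cdot\, c\to d$ iff either $\uparrow^e_{\mathfrak A}(a\to b)\cup\uparrow^e_{\mathfrak A}(c\to d)$ consists only of trivial equations, or $\uparrow^e_{\mathfrak A}(a\to b:\cdot\, c\to d)$ contains a non-trivial equation and for every $d'$, $\emptyset^e\subsetneq\uparrow^e(a\to b:\cdot\, c\to d)\subseteq\uparrow^e(a\to b:\cdot\, c\to d')$ implies $\emptyset^e\subsetneq\uparrow^e(a\to b:\cdot\, c\to d')\subseteq\uparrow^e(a\to b:\cdot\, c\to d)$. $\mathfrak A\models_e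 a:b::c:d$ iff $\mathfrak A\models_e a\to b:\cdot\, c\to d$, $b\to a:\cdot\, d\to c$, $c\to d:\cdot\, a\to b$ and $d\to c:\cdot\, b\to a$. Here $a-b$ denotes integer subtraction. -}

module Defs where

open import Data.Nat using (ℕ; suc)
open import Data.Product using (_×_)
open import Data.Sum using (_⊎_)
open import Data.Vec using (Vec; []; _∷_)
open import Data.Vec.Relation.Unary.Any using (Any)
open import Relation.Binary.Construct.Closure.ReflexiveTransitive using (Star)
open import Relation.Binary.PropositionalEquality using (_≡_)
open import Relation.Unary using (Pred; _∈_; _⊆_; _⊂_; _∩_; _∪_; _∖_; Satisfiable)

-- Equations mention no relation symbols, so a language is given by its
-- function symbols; constants are function symbols of arity 0.
record Language : Set₁ where
  field
    Fun   : Set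
    arity : Fun → ℕ

record Structure (L : Language) : Set₁ where
  open Language L
  field
    Carrier : Set
    ⟦_⟧     : (f : Fun) → Vec Carrier (arity f) → Carrier

data Var : Set where
  x y : Var

module Syntax (L : Language) where
  open Language L

  data Term : Set where
    var : Var → Term
    app : (f : Fun) → Vec Term (arity f) → Term

  infix 5 _≈_

  data Equation : Set where
    _≈_ : Term → Term → Equation

  data OccursInTerm (v : Var) : Term → Set where
    here  : OccursInTerm v (var v)
    there : ∀ {f ts} → Any (OccursInTerm v) ts → OccursInTerm v (app f ts)

  OccursIn : Equation → Pred Var _
  OccursIn (s ≈ t) v = OccursInTerm v s ⊎ OccursInTerm v t

  -- Edges of the dependency graph: an equation is atomic, so it is itself
  -- its only atomic subformula.
  DependencyEdge : Equation → Var → Var → Set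
  DependencyEdge e u v = u ∈ OccursIn e × v ∈ OccursIn e

  DependencyGraphConnected : Equation → Set
  DependencyGraphConnected e =
    ∀ u v → u ∈ OccursIn e → v ∈ OccursIn e → Star (DependencyEdge e) u v

  -- Terms are built over x and y only and equations have no quantifiers, so
  -- "the free variables are exactly x and y" says that every Var occurs.
  CFormula : Pred Equation _
  CFormula e = (∀ v → v ∈ OccursIn e) × DependencyGraphConnected e

module Proportions {L : Language} (𝔄 : Structure L) where
  open Language L
  open Structure 𝔄 renaming (Carrier to A)
  open Syntax L public

  valuation : A → A → Var → A
  valuation a b x = a
  valuation a b y = b

  mutual
    eval : (Var → A) → Term → A
    eval ρ (var v)    = ρ v
    eval ρ (app f ts) = ⟦ f ⟧ (evalAll ρ ts)

    evalAll : ∀ {n} → (Var → A) → Vec Term n → Vec A n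
    evalAll ρ []       = []
    evalAll ρ (t ∷ ts) = eval ρ t ∷ evalAll ρ ts

  Holds : A → A → Pred Equation _
  Holds a b (s ≈ t) = eval (valuation a b) s ≡ eval (valuation a b) t

  ↑[_⟶_] : A → A → Pred Equation _
  ↑[ a ⟶ b ] = CFormula ∩ Holds a b

  ↑[_⟶_∶·_⟶_] : A → A → A → A → Pred Equation _
  ↑[ a ⟶ b ∶· c ⟶ d ] = ↑[ a ⟶ b ] ∩ ↑[ c ⟶ d ]

  ∅ᵉ : Pred Equation _
  ∅ᵉ e = ∀ a b c d → e ∈ ↑[ a ⟶ b ∶· c ⟶ d ]

  ArrowProportion : A → A → A → A → Set
  ArrowProportion a b c d =
      (↑[ a ⟶ b ] ∪ ↑[ c ⟶ d ] ⊆ ∅ᵉ)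
    ⊎ ( Satisfiable (↑[ a ⟶ b ∶· c ⟶ d ] ∖ ∅ᵉ)
      × (∀ d′ →
           (∅ᵉ ⊂ ↑[ a ⟶ b ∶· c ⟶ d ]
             × ↑[ a ⟶ b ∶· c ⟶ d ] ⊆ ↑[ a ⟶ b ∶· c ⟶ d′ ]) →
           (∅ᵉ ⊂ ↑[ a ⟶ b ∶· c ⟶ d′ ]
             × ↑[ a ⟶ b ∶· c ⟶ d′ ] ⊆ ↑[ a ⟶ b ∶· c ⟶ d ])))

  Proportion : A → A → A → A → Set
  Proportion a b c d =
      ArrowProportion a b c d
    × ArrowProportion b a d c
    × ArrowProportion c d a b
    × ArrowProportion d c b a

infix 4 _⊨ₑ_∶_∶∶_∶_

_⊨ₑ_∶_∶∶_∶_ : {L : Language} (𝔄 : Structure L) →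
             let open Structure 𝔄 in Carrier → Carrier → Carrier → Carrier → Set
𝔄 ⊨ₑ a ∶ b ∶∶ c ∶ d = Proportions.Proportion 𝔄 a b c d

data SuccSymbol : Set where
  S : SuccSymbol

succLanguage : Language
succLanguage = record { Fun = SuccSymbol ; arity = λ { S → 1 } }

⟨ℕ,S⟩ : Structure succLanguage
⟨ℕ,S⟩ = record { Carrier = ℕ ; ⟦_⟧ = λ { S (n ∷ []) → suc n } }

{-# OPTIONS --safe #-}
-- A term over S is Sᵏ v for a single variable v, so a c-formula is, up to
-- symmetry, Sᵏ x = Sˡ y; it holds at (p , q) iff p - q = l - k.  Hence no
-- equation is trivial, and one common justification of a → b and c → d already
-- forces a - b = c - d.  Conversely, Sᵇ x = Sᵃ y always justifies a → b, and it
-- determines d from c.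
module Submission where

open import Defs
open import Data.Nat using (ℕ; zero; suc)
import Data.Nat as ℕ
import Data.Nat.Properties as ℕ
open import Data.Integer using (+_; _-_; _+_; _⊖_)
open import Data.Integer.Properties using (+-cancelˡ-⊖; [+m]-[+n]≡m⊖n; +-injective)
open import Data.Integer.Tactic.RingSolver using (solve-∀)
open import Data.Product using (_,_)
open import Data.Sum using (inj₁; inj₂)
open import Data.Vec using ([]; _∷_)
open import Data.Vec.Relation.Unary.Any using (here; there)
open import Function.Base using (id)
open import Function.Bundles using (_⇔_; mk⇔)
open import Relation.Binary.Construct.Closure.ReflexiveTransitive using (ε; _◅_)
open import Relation.Binary.PropositionalEquality
  using (_≡_; refl; sym; trans; cong; cong₂; module ≡-Reasoning)
open import Relation.Nullary using (¬_; contradiction)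
open import Relation.Unary using (_∈_; _∉_)

open Proportions ⟨ℕ,S⟩
open ≡-Reasoning

-- Shifting `m ⊖ n` by `k` and `l ⊖ k` by `n` produces the same pair, by the hypothesis. In use `k`
-- and `l` are term depths, `m` and `n` the values of the variables.
+≡+⇒-≡- : ∀ k l {m n} → k ℕ.+ m ≡ l ℕ.+ n → + m - + n ≡ + l - + k
+≡+⇒-≡- k l {m} {n} k+m≡l+n = begin
  + m - + n                ≡⟨ [+m]-[+n]≡m⊖n m n ⟩
  m ⊖ n                    ≡⟨ +-cancelˡ-⊖ k m n ⟨
  (k ℕ.+ m) ⊖ (k ℕ.+ n)    ≡⟨ cong₂ _⊖_ (trans k+m≡l+n (ℕ.+-comm l n)) (ℕ.+-comm k n) ⟩
  (n ℕ.+ l) ⊖ (n ℕ.+ k)    ≡⟨ +-cancelˡ-⊖ n l k ⟩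
  l ⊖ k                    ≡⟨ [+m]-[+n]≡m⊖n l k ⟨
  + l - + k                ∎

-≡-⇒+≡+ : ∀ k l m n → + m - + n ≡ + l - + k → k ℕ.+ m ≡ l ℕ.+ n
-- `+ k + + m` computes to `+ (k ℕ.+ m)`, so the equality may be proved in ℤ, where subtraction is
-- available.
-≡-⇒+≡+ k l m n m-n≡l-k = +-injective (begin
  + k + + m                ≡⟨ split (+ k) (+ m) (+ n) ⟩
  + k + (+ m - + n) + + n  ≡⟨ cong (λ i → + k + i + + n) m-n≡l-k ⟩
  + k + (+ l - + k) + + n  ≡⟨ cancel (+ k) (+ l) (+ n) ⟩
  + l + + n                ∎)
  where
  split : ∀ i j h → i + j ≡ i + (j - h) + h
  split = solve-∀
  cancel : ∀ i j h → i + (j - i) + h ≡ j + h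
  cancel = solve-∀

depth : Term → ℕ
depth (var v)          = zero
depth (app S (t ∷ [])) = suc (depth t)

variable-of : Term → Var
variable-of (var v)          = v
variable-of (app S (t ∷ [])) = variable-of t

eval-depth : ∀ ρ t → eval ρ t ≡ depth t ℕ.+ ρ (variable-of t)
eval-depth ρ (var v)          = refl
eval-depth ρ (app S (t ∷ [])) = cong suc (eval-depth ρ t)

occurs⇒variable-of : ∀ {v} t → OccursInTerm v t → variable-of t ≡ v
occurs⇒variable-of (var v)          here             = refl
occurs⇒variable-of (app S (t ∷ [])) (there (here o)) = occurs⇒variable-of t o

x-and-y-not-in-one-term : ∀ t → OccursInTerm x t → ¬ OccursInTerm y t
x-and-y-not-in-one-term t ox oy
  with () ← trans (sym (occurs⇒variable-of t ox)) (occurs⇒variable-of t oy)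

eval-occurs : ∀ {v} ρ t → OccursInTerm v t → eval ρ t ≡ depth t ℕ.+ ρ v
eval-occurs ρ t o =
  trans (eval-depth ρ t) (cong (λ v → depth t ℕ.+ ρ v) (occurs⇒variable-of t o))

-- The right-hand side depends on the equation alone, so any two pairs satisfying it have the same
-- difference.
holds⇒-≡- : ∀ {p q} s t → OccursInTerm x s → OccursInTerm y t →
            Holds p q (s ≈ t) → + p - + q ≡ + depth t - + depth s
holds⇒-≡- s t ox oy h = +≡+⇒-≡- (depth s) (depth t)
  (trans (sym (eval-occurs _ s ox)) (trans h (eval-occurs _ t oy)))

-- A c-formula contains both variables and a term only one, so `x` and `y` lie on opposite sides.
common-justification⇒-≡- : ∀ {a b c d} e → e ∈ ↑[ a ⟶ b ∶· c ⟶ d ] → + a - + b ≡ + c - + d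
common-justification⇒-≡- (s ≈ t) (((occ , _) , hab) , (_ , hcd)) with occ x | occ y
... | inj₁ ox | inj₁ oy = contradiction oy (x-and-y-not-in-one-term s ox)
... | inj₂ ox | inj₂ oy = contradiction oy (x-and-y-not-in-one-term t ox)
... | inj₁ ox | inj₂ oy = trans (holds⇒-≡- s t ox oy hab) (sym (holds⇒-≡- s t ox oy hcd))
... | inj₂ ox | inj₁ oy =
  trans (holds⇒-≡- t s ox oy (sym hab)) (sym (holds⇒-≡- t s ox oy (sym hcd)))

no-trivial-equation : ∀ {e} → e ∉ ∅ᵉ
-- The pairs (0, 0) and (0, 1) have differences 0 and -1, so they share no justification.
no-trivial-equation {e} e∈∅ with () ← common-justification⇒-≡- e (e∈∅ 0 0 0 1)

S^ : ℕ → Term → Term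
S^ zero    t = t
S^ (suc n) t = app S (S^ n t ∷ [])

eval-S^ : ∀ ρ n t → eval ρ (S^ n t) ≡ n ℕ.+ eval ρ t
eval-S^ ρ zero    t = refl
eval-S^ ρ (suc n) t = cong suc (eval-S^ ρ n t)

occurs-S^ : ∀ {v} n t → OccursInTerm v t → OccursInTerm v (S^ n t)
occurs-S^ zero    t o = o
occurs-S^ (suc n) t o = there (here (occurs-S^ n t o))

-- The exponents are crossed: at `(a , b)` both sides are the sum of `a` and `b`, and at `(c , d)`
-- the equation reads `b ℕ.+ c ≡ a ℕ.+ d`, the subtraction-free form of equal differences.
justification : ℕ → ℕ → Equation
justification a b = S^ b (var x) ≈ S^ a (var y)

justification-cFormula : ∀ a b → CFormula (justification a b)
justification-cFormula a b = occ , λ u v ou ov → (ou , ov) ◅ ε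
  where
  occ : ∀ v → OccursIn (justification a b) v
  occ x = inj₁ (occurs-S^ b (var x) here)
  occ y = inj₂ (occurs-S^ a (var y) here)

+≡+⇒justification-holds : ∀ {a b c d} → b ℕ.+ c ≡ a ℕ.+ d → Holds c d (justification a b)
+≡+⇒justification-holds {a} {b} {c} {d} b+c≡a+d =
  trans (eval-S^ _ b (var x)) (trans b+c≡a+d (sym (eval-S^ _ a (var y))))

justification-holds⇒+≡+ : ∀ {a b c d} → Holds c d (justification a b) → b ℕ.+ c ≡ a ℕ.+ d
justification-holds⇒+≡+ {a} {b} {c} {d} h =
  trans (sym (eval-S^ _ b (var x))) (trans h (eval-S^ _ a (var y)))

justification-∈ : ∀ a b → justification a b ∈ ↑[ a ⟶ b ]
justification-∈ a b = justification-cFormula a b , +≡+⇒justification-holds {a} {b} (ℕ.+-comm b a)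

+≡+⇒arrow : ∀ a b c d → b ℕ.+ c ≡ a ℕ.+ d → ArrowProportion a b c d
+≡+⇒arrow a b c d b+c≡a+d = inj₂ ((justification a b , common , no-trivial-equation) , maximal)
  where
  common : justification a b ∈ ↑[ a ⟶ b ∶· c ⟶ d ]
  common = justification-∈ a b , justification-cFormula a b , +≡+⇒justification-holds {a} {b} b+c≡a+d

  maximal : ∀ d′ → _ → _
  -- The inclusion carries `justification a b` over to `(c , d′)`; cancelling `a` then gives
  -- `d′ ≡ d`, and both sets coincide.
  maximal d′ (nonempty , ⊆d′) with ⊆d′ common
  ... | _ , _ , holds-d′
    with refl ← ℕ.+-cancelˡ-≡ a d d′ (trans (sym b+c≡a+d) (justification-holds⇒+≡+ {a} {b} holds-d′))
    = nonempty , id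

arrow⇒-≡- : ∀ {a b c d} → ArrowProportion a b c d → + a - + b ≡ + c - + d
-- This disjunct is impossible: it would make `justification a b` trivial.
arrow⇒-≡- {a} {b} (inj₁ trivial) =
  contradiction (trivial (inj₁ (justification-∈ a b))) no-trivial-equation
arrow⇒-≡- (inj₂ ((e , common , _) , _)) = common-justification⇒-≡- e common

theorem13 : ∀ (a b c d : ℕ) → (⟨ℕ,S⟩ ⊨ₑ a ∶ b ∶∶ c ∶ d) ⇔ (+ a - + b ≡ + c - + d)
theorem13 a b c d = mk⇔ (λ { (arrow , _) → arrow⇒-≡- arrow }) backward
  where
  backward : + a - + b ≡ + c - + d → ⟨ℕ,S⟩ ⊨ₑ a ∶ b ∶∶ c ∶ d
  backward a-b≡c-d =
      -- All four arrows reduce to the single identity `d ℕ.+ a ≡ c ℕ.+ b`, up to commutativity and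
      -- symmetry.
      +≡+⇒arrow a b c d (trans (ℕ.+-comm b c) (sym a+d≡c+b))
    , +≡+⇒arrow b a d c (trans a+d≡c+b (ℕ.+-comm c b))
    , +≡+⇒arrow c d a b d+a≡c+b
    , +≡+⇒arrow d c b a (sym d+a≡c+b)
    where
    d+a≡c+b : d ℕ.+ a ≡ c ℕ.+ b
    d+a≡c+b = -≡-⇒+≡+ d c a b a-b≡c-d

    a+d≡c+b : a ℕ.+ d ≡ c ℕ.+ b
    a+d≡c+b = trans (ℕ.+-comm a d) d+a≡c+b
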